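{- Let $n$ be a positive integer and let $A(n)=(a_{ij})_{i,j\in\mathbb{N}}$ be the greedy matrix described in the context. For every $k\geq 1$, the length of the $k$-th row of $A(n)$ is less than $2n^3-n(n-3)$.
   Context: $\mathbb{N}=\{1,2,3,\dots\}$. Fix a positive integer $n$. The infinite $\{0,1\}$-matrix $A(n)=(a_{ij})_{i,j\in\mathbb{N}}$ is defined recursively. Its entries are determined row by row (row $1$ first), and within each row from left to right, so that $a_{kl}$ is determined after all $a_{ij}$ with $i<k$ and all $a_{kj}$ with $j<l$. One sets $a_{kl}=1$ if and only if all of the following hold: (1) $\sum_{j<l}a_{kj}<n+1$; (2) $\sum_{i<k}a_{il}<n+1$; (3) there is no pair $(i,j)$ with $1\le i<k$, $1\le j<l$ and $a_{ij}=a_{il}=a_{kj}=1$. Otherwise $a_{kl}=0$. The length of a row $(a_{k1},a_{k2},\dots)$ containing at least one but finitely many ones is $l-f+1$, where $f$ and $l$ are the smallest and the largest column index $j$ with $a_{kj}=1$. -}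

module Defs where

open import Data.Bool using (if_then_else_)
open import Data.List using (applyUpTo)
open import Data.Nat using (ℕ; zero; suc; _+_; _∸_; _≤_; _<_; z≤n; s≤s; _≟_; _<?_)
open import Data.Nat.Properties using (anyUpTo?; <⇒≢; m<1+n⇒m<n∨m≡n)
open import Data.Nat.ListAction using (sum)
open import Data.Product using (_×_; _,_; ∃-syntax)
open import Data.Sum using (_⊎_; inj₁; inj₂)
open import Function using (_∘_)
open import Relation.Nullary using (¬_; Dec; does; ¬?)
open import Relation.Nullary.Decidable using (_×-dec_; dec-true; dec-false)
open import Relation.Binary.PropositionalEquality using (_≡_; refl; sym; trans; cong; cong₂; subst)

-- Rows and columns are numbered from 0, so the index i stands for row or
-- column i + 1 of the matrix; lengths of rows do not depend on the choice.
Matrix : Set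
Matrix = ℕ → ℕ → ℕ

∑<_ : ℕ → (ℕ → ℕ) → ℕ
(∑< m) f = sum (applyUpTo f m)

Admissible : ℕ → Matrix → ℕ → ℕ → Set
Admissible n a k l =
    (∑< l) (λ j → a k j) < n + 1
  × (∑< k) (λ i → a i l) < n + 1
  × ¬ (∃[ i ] i < k × ∃[ j ] j < l × a i j ≡ 1 × a i l ≡ 1 × a k j ≡ 1)

admissible? : ∀ n a k l → Dec (Admissible n a k l)
admissible? n a k l =
  (_ <? _) ×-dec (_ <? _) ×-dec
  ¬? (anyUpTo? (λ i → anyUpTo? (λ j → (a i j ≟ 1) ×-dec (a i l ≟ 1) ×-dec (a k j ≟ 1)) l) k)

-- filled n k l is the state of the construction just before the entry (k , l)
-- is determined: all rows i < k and the entries j < l of row k are in place,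
-- and every other entry is 0.
mutual
  A : ℕ → Matrix
  A n k l = if does (admissible? n (filled n k l) k l) then 1 else 0

  filled : ℕ → ℕ → ℕ → Matrix
  filled n k zero    i j = above n k i j
  filled n k (suc l) i j =
    if does ((i ≟ k) ×-dec (j ≟ l)) then A n k l else filled n k l i j

  above : ℕ → ℕ → Matrix
  above n zero    i j = 0
  above n (suc k) i j = if does (i ≟ k) then A n k j else above n k i j

-- The length is defined only for rows with at least one and finitely many
-- ones, hence a relation: HasLength r m says that r is such a row and that m
-- is its length.
record HasLength (r : ℕ → ℕ) (m : ℕ) : Set where
  field
    first last    : ℕ
    first-one     : r first ≡ 1
    first-minimal : ∀ j → r j ≡ 1 → first ≤ j
    last-one      : r last ≡ 1
    last-maximal  : ∀ j → r j ≡ 1 → j ≤ last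
    length        : m ≡ last ∸ first + 1

private
  ∑-cong : ∀ {f g : ℕ → ℕ} m → (∀ i → i < m → f i ≡ g i) → (∑< m) f ≡ (∑< m) g
  ∑-cong zero    h = refl
  ∑-cong (suc m) h = cong₂ _+_ (h 0 (s≤s z≤n)) (∑-cong m (λ i i<m → h (suc i) (s≤s i<m)))

  Before : ℕ → ℕ → ℕ → ℕ → Set
  Before k l i j = i < k ⊎ (i ≡ k × j < l)

  Admissible-cong : ∀ n {a b} k l → (∀ i j → Before k l i j → a i j ≡ b i j) →
                    Admissible n a k l → Admissible n b k l
  Admissible-cong n k l h (row , col , rect) =
      subst (_< n + 1) (∑-cong l (λ j j<l → h k j (inj₂ (refl , j<l)))) row
    , subst (_< n + 1) (∑-cong k (λ i i<k → h i l (inj₁ i<k))) col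
    , λ (i , i<k , j , j<l , p , q , r) → rect
        ( i , i<k , j , j<l
        , trans (h i j (inj₁ i<k)) p
        , trans (h i l (inj₁ i<k)) q
        , trans (h k j (inj₂ (refl , j<l))) r )

  if-yes : ∀ {P : Set} {x y : ℕ} (P? : Dec P) → P → (if does P? then x else y) ≡ x
  if-yes P? p = cong (if_then _ else _) (dec-true P? p)

  if-no : ∀ {P : Set} {x y : ℕ} (P? : Dec P) → ¬ P → (if does P? then x else y) ≡ y
  if-no P? ¬p = cong (if_then _ else _) (dec-false P? ¬p)

  above-before : ∀ n k i j → i < k → above n k i j ≡ A n i j
  above-before n (suc k) i j i<1+k with m<1+n⇒m<n∨m≡n i<1+k
  ... | inj₁ i<k  = trans (if-no (i ≟ k) (<⇒≢ i<k)) (above-before n k i j i<k)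
  ... | inj₂ refl = if-yes (i ≟ k) refl

  filled-before : ∀ n k l i j → Before k l i j → filled n k l i j ≡ A n i j
  filled-before n k zero    i j (inj₁ i<k) = above-before n k i j i<k
  filled-before n k (suc l) i j (inj₁ i<k) =
    trans (if-no ((i ≟ k) ×-dec (j ≟ l)) λ (i≡k , _) → <⇒≢ i<k i≡k)
          (filled-before n k l i j (inj₁ i<k))
  filled-before n k (suc l) i j (inj₂ (refl , j<1+l)) with m<1+n⇒m<n∨m≡n j<1+l
  ... | inj₁ j<l  = trans (if-no ((i ≟ k) ×-dec (j ≟ l)) λ (_ , j≡l) → <⇒≢ j<l j≡l)
                          (filled-before n k l i j (inj₂ (refl , j<l)))
  ... | inj₂ refl = if-yes ((i ≟ k) ×-dec (j ≟ l)) (refl , refl)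

-- A n satisfies the greedy rule with respect to its own entries.
A-one : ∀ n k l → Admissible n (A n) k l → A n k l ≡ 1
A-one n k l adm = if-yes (admissible? n (filled n k l) k l)
  (Admissible-cong n k l (λ i j b → sym (filled-before n k l i j b)) adm)

A-zero : ∀ n k l → ¬ Admissible n (A n) k l → A n k l ≡ 0
A-zero n k l ¬adm = if-no (admissible? n (filled n k l) k l)
  (¬adm ∘ Admissible-cong n k l (filled-before n k l))

{-# OPTIONS --safe #-}

-- Let row k have ones in columns f ≤ l. A column c between f and l is of one of three kinds.
--   * It carries a one of row k: at most n + 1 columns.
--   * It is blocked by a rectangle through a one of row k left of l: at most n · n · n columns.
--   * It already has n + 1 ones above row k. A row i < k with a one at c > f has room left at
--     column f, and so has column f at row i; hence row i either has a one at f or is blocked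
--     there by a rectangle i' < i, j < f. As f has at most n ones above row k, at most n⁴ ones
--     lie right of f above row k and so there are at most n⁴ / (n + 1) such columns.
-- The same bound for all ones of row k makes its last one computable.
module Submission where

open import Defs
open import Data.Nat using (ℕ; _≤_)
open import Data.Integer using (+_; _*_; _-_; _^_; _<_)
open import Data.Product using (_×_; ∃-syntax)

open import Data.List using (List; []; _∷_; _++_; [_]; map; length; filter; concatMap; upTo; applyUpTo; cartesianProduct)
open import Data.List.Properties using (length-++; length-map; length-applyUpTo; map-upTo; map-++; map-∘; applyUpTo-∷ʳ; filter-notAll)
open import Data.List.Membership.Propositional using (_∈_; lose)
open import Data.List.Membership.Propositional.Properties using (∈-∃++; ∈-++⁺ˡ; ∈-++⁺ʳ; ∈-++⁻; ∈-filter⁺; ∈-filter⁻; ∈-upTo⁺; ∈-upTo⁻; ∈-map⁺; ∈-applyUpTo⁻; ∈-cartesianProduct⁻)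
open import Data.List.Relation.Binary.Subset.Propositional using (_⊆_)
open import Data.List.Relation.Unary.All as All using ()
open import Data.List.Relation.Unary.AllPairs using ([]; _∷_)
open import Data.List.Relation.Unary.Any using (here; there)
open import Data.List.Relation.Unary.Any.Properties using (concatMap⁺)
open import Data.List.Relation.Unary.Unique.Propositional using (Unique)
open import Data.List.Relation.Unary.Unique.Propositional.Properties as Unique using ()
open import Data.Nat using (zero; suc; _+_; _∸_; _⊔_; z≤n; s≤s; z<s; _≟_; _<?_)
open import Data.Nat.ListAction using (sum)
open import Data.Nat.ListAction.Properties using (sum-++)
open import Data.Nat.Properties
open import Data.Nat.Tactic.RingSolver using (solve-∀)
open import Data.Product using (_,_; proj₁; proj₂; uncurry)
open import Data.Sum using (_⊎_; inj₁; inj₂)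
open import Function using (_∘_)
open import Relation.Binary.PropositionalEquality using (_≡_; _≢_; refl; sym; trans; cong; cong₂; subst; module ≡-Reasoning)
open import Relation.Nullary using (¬_; Dec; yes; no; ¬?; contradiction)
open import Relation.Nullary.Decidable using (_×-dec_; decidable-stable)
open import Relation.Unary using (Decidable)
import Data.Integer as ℤ
import Data.Integer.Properties as ℤ
import Data.Integer.Tactic.RingSolver as ℤ-Solver
import Data.Nat as ℕ

-- Counting with lists.

module _ {X : Set} where

  -- Induction on `xs`: deleting one occurrence of `x` from `ys` loses no later element of `xs`,
  -- since these all differ from `x`. The larger list may contain repetitions.
  length-⊆ : {xs ys : List X} → Unique xs → xs ⊆ ys → length xs ≤ length ys
  length-⊆ [] _ = z≤n
  length-⊆ {x ∷ xs} (x∉xs ∷ xs!) xs⊆ys with ∈-∃++ (xs⊆ys (here refl))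
  ... | us , vs , refl = begin
    suc (length xs)                ≤⟨ s≤s (length-⊆ xs! avoid) ⟩
    suc (length (us ++ vs))        ≡⟨ cong suc (length-++ us) ⟩
    suc (length us + length vs)    ≡⟨ +-suc (length us) (length vs) ⟨
    length us + suc (length vs)    ≡⟨ length-++ us ⟨
    length (us ++ x ∷ vs)          ∎
    where
    open ≤-Reasoning
    avoid : xs ⊆ us ++ vs
    avoid {y} y∈xs with ∈-++⁻ us (xs⊆ys (there y∈xs))
    ... | inj₁ y∈us         = ∈-++⁺ˡ y∈us
    ... | inj₂ (here refl)  = contradiction refl (All.lookup x∉xs y∈xs)
    ... | inj₂ (there y∈vs) = ∈-++⁺ʳ us y∈vs

  length-concatMap-≤ : {Y : Set} (f : X → List Y) {c d : ℕ} (xs : List X) → length xs ≤ d →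
                       (∀ {x} → x ∈ xs → length (f x) ≤ c) →
                       length (concatMap f xs) ≤ d ℕ.* c
  length-concatMap-≤ f []       _         _ = z≤n
  length-concatMap-≤ f (x ∷ xs) (s≤s len) h = ≤-trans (≤-reflexive (length-++ (f x)))
    (+-mono-≤ (h (here refl)) (length-concatMap-≤ f xs len (h ∘ there)))

  ∈-concatMap⁺ : {Y : Set} (f : X → List Y) {xs : List X} {x : X} {y : Y} →
                 x ∈ xs → y ∈ f x → y ∈ concatMap f xs
  ∈-concatMap⁺ f x∈xs y∈fx = concatMap⁺ f (lose x∈xs y∈fx)

  Binary : (X → ℕ) → Set
  Binary h = ∀ x → h x ≡ 0 ⊎ h x ≡ 1

  length-filter-ones : {h : X → ℕ} → Binary h → ∀ xs →
                       length (filter (λ x → h x ≟ 1) xs) ≡ sum (map h xs)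
  length-filter-ones     bin []       = refl
  length-filter-ones {h} bin (x ∷ xs) with h x | bin x
  ... | _ | inj₁ refl = length-filter-ones bin xs
  ... | _ | inj₂ refl = cong suc (length-filter-ones bin xs)

-- One half of a double count: it will be applied to the full columns, each of which contributes at
-- least `n + 1` ones.
sum-cartesianProduct-≥ : ∀ {X Y : Set} (h : X × Y → ℕ) (c : ℕ) xs ys →
                         (∀ {x} → x ∈ xs → c ≤ sum (map (λ y → h (x , y)) ys)) →
                         length xs ℕ.* c ≤ sum (map h (cartesianProduct xs ys))
sum-cartesianProduct-≥ h c []       ys _     = z≤n
sum-cartesianProduct-≥ h c (x ∷ xs) ys bound = begin
  c + length xs ℕ.* c
    ≤⟨ +-mono-≤ (bound (here refl)) (sum-cartesianProduct-≥ h c xs ys (bound ∘ there)) ⟩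
  sum (map (λ y → h (x , y)) ys) + sum (map h (cartesianProduct xs ys))
    ≡⟨ cong (λ zs → sum zs + _) (map-∘ ys) ⟩
  sum (map h (map (x ,_) ys)) + sum (map h (cartesianProduct xs ys))
    ≡⟨ sum-++ (map h (map (x ,_) ys)) _ ⟨
  sum (map h (map (x ,_) ys) ++ map h (cartesianProduct xs ys))
    ≡⟨ cong sum (map-++ h (map (x ,_) ys) _) ⟨
  sum (map h (map (x ,_) ys ++ cartesianProduct xs ys)) ∎
  where open ≤-Reasoning

-- Partial sums and positions of ones in 0/1 sequences.

∑-suc : ∀ h m → (∑< suc m) h ≡ (∑< m) h + h m
∑-suc h m = begin
  sum (applyUpTo h (suc m))        ≡⟨ cong sum (applyUpTo-∷ʳ h m) ⟨
  sum (applyUpTo h m ++ [ h m ])   ≡⟨ sum-++ (applyUpTo h m) [ h m ] ⟩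
  (∑< m) h + (h m + 0)             ≡⟨ cong ((∑< m) h ℕ.+_) (+-identityʳ (h m)) ⟩
  (∑< m) h + h m                   ∎
  where open ≡-Reasoning

∑-mono-≤ : ∀ h {m p} → m ≤ p → (∑< m) h ≤ (∑< p) h
∑-mono-≤ h z≤n       = z≤n
∑-mono-≤ h (s≤s m≤p) = +-monoʳ-≤ (h 0) (∑-mono-≤ (h ∘ suc) m≤p)

∑-zero : ∀ {h} m → (∀ x → x ℕ.< m → h x ≡ 0) → (∑< m) h ≡ 0
∑-zero zero    _ = refl
∑-zero (suc m) z = cong₂ _+_ (z 0 z<s) (∑-zero m (λ x x<m → z (suc x) (s≤s x<m)))

-- The greedy rule limits a sum only at the moment a one is placed. Since the partial sums grow only
-- at ones, the limit carries over to all of them.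
∑-bounded : ∀ {h c} → Binary h → (∀ x → h x ≡ 1 → (∑< x) h ℕ.< c) → ∀ m → (∑< m) h ≤ c
∑-bounded         bin bound zero    = z≤n
∑-bounded {h} {c} bin bound (suc m) with bin m
... | inj₁ hm≡0 = begin
  (∑< suc m) h    ≡⟨ ∑-suc h m ⟩
  (∑< m) h + h m  ≡⟨ cong ((∑< m) h ℕ.+_) hm≡0 ⟩
  (∑< m) h + 0    ≡⟨ +-identityʳ _ ⟩
  (∑< m) h        ≤⟨ ∑-bounded bin bound m ⟩
  c               ∎
  where open ≤-Reasoning
... | inj₂ hm≡1 = begin
  (∑< suc m) h    ≡⟨ ∑-suc h m ⟩
  (∑< m) h + h m  ≡⟨ cong ((∑< m) h ℕ.+_) hm≡1 ⟩
  (∑< m) h + 1    ≡⟨ +-comm _ 1 ⟩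
  suc ((∑< m) h)  ≤⟨ bound m hm≡1 ⟩
  c               ∎
  where open ≤-Reasoning

-- Opaque so that unification recovers h and m from ones h m.
opaque
  ones : (ℕ → ℕ) → ℕ → List ℕ
  ones h m = filter (λ x → h x ≟ 1) (upTo m)

  ∈-ones⁺ : ∀ {h m x} → x ℕ.< m → h x ≡ 1 → x ∈ ones h m
  ∈-ones⁺ {h} x<m = ∈-filter⁺ (λ x → h x ≟ 1) (∈-upTo⁺ x<m)

  ∈-ones⁻ : ∀ {h m x} → x ∈ ones h m → x ℕ.< m × h x ≡ 1
  ∈-ones⁻ {h} {m} x∈ with ∈-filter⁻ (λ x → h x ≟ 1) {xs = upTo m} x∈
  ... | x∈upTo , hx≡1 = ∈-upTo⁻ x∈upTo , hx≡1

  length-ones : ∀ {h} → Binary h → ∀ m → length (ones h m) ≡ (∑< m) h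
  length-ones {h} bin m = trans (length-filter-ones bin (upTo m)) (cong sum (map-upTo h m))

  -- Leaving out the one at `x`, through which a line is entered, lowers the number of choices on
  -- that line from `n + 1` to `n`.
  otherOnes : (ℕ → ℕ) → ℕ → ℕ → List ℕ
  otherOnes h m x = filter (λ y → ¬? (y ≟ x)) (ones h m)

  ∈-otherOnes⁺ : ∀ {h m x y} → y ℕ.< m → h y ≡ 1 → y ≢ x → y ∈ otherOnes h m x
  ∈-otherOnes⁺ {h} {x = x} y<m hy≡1 = ∈-filter⁺ (λ y → ¬? (y ≟ x)) (∈-ones⁺ {h} y<m hy≡1)

  ∈-otherOnes⁻ : ∀ {h m x y} → y ∈ otherOnes h m x → y ℕ.< m × h y ≡ 1
  ∈-otherOnes⁻ {h} {m} {x} y∈ =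
    ∈-ones⁻ {h} {m} (proj₁ (∈-filter⁻ (λ y → ¬? (y ≟ x)) {xs = ones h m} y∈))

  length-otherOnes : ∀ {h m x} → Binary h → x ℕ.< m → h x ≡ 1 →
                     length (otherOnes h m x) ℕ.< (∑< m) h
  length-otherOnes {h} {m} {x} bin x<m hx≡1 = ≤-trans
    (filter-notAll (λ y → ¬? (y ≟ x)) (ones h m)
      (lose (∈-ones⁺ {h} x<m hx≡1) (λ x≢x → x≢x refl)))
    (≤-reflexive (length-ones bin m))

-- Bounded search for extreme elements.

least : {P : ℕ → Set} → Decidable P → ∀ m → P m → ∃[ f ] P f × (∀ x → P x → f ≤ x)
least P? zero    p = 0 , p , λ _ _ → z≤n
least P? (suc m) p with P? 0
... | yes p₀ = 0 , p₀ , λ _ _ → z≤n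
... | no ¬p₀ with least (P? ∘ suc) m p
...   | f , pf , min = suc f , pf , λ where
        zero    p₀ → contradiction p₀ ¬p₀
        (suc x) px → s≤s (min x px)

greatest : {P : ℕ → Set} → Decidable P → ∀ {m} → P m → ∀ b → (∀ x → P x → x ≤ b) →
           ∃[ l ] P l × (∀ x → P x → x ≤ l)
greatest {P} P? {m} p zero    bound = 0 , subst P (n≤0⇒n≡0 (bound m p)) p , bound
greatest     P?     p (suc b) bound with P? (suc b)
... | yes pb = suc b , pb , bound
... | no ¬pb = greatest P? p b λ x px →
  ≤-pred (≤∧≢⇒< (bound x px) λ where refl → ¬pb px)

-- Matrices obeying the greedy rule.

module Greedy (n : ℕ) (1≤n : 1 ≤ n) (a : Matrix)
  (binary : ∀ k l → a k l ≡ 0 ⊎ a k l ≡ 1)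
  (one⁺ : ∀ k l → Admissible n a k l → a k l ≡ 1)
  (one⁻ : ∀ k l → a k l ≡ 1 → Admissible n a k l)
  where

  row col : ℕ → ℕ → ℕ
  row i j = a i j
  col j i = a i j

  row-binary : ∀ i → Binary (row i)
  row-binary i j = binary i j

  col-binary : ∀ j → Binary (col j)
  col-binary j i = binary i j

  <n+1⇒≤n : ∀ {m} → m ℕ.< n + 1 → m ≤ n
  <n+1⇒≤n {m} m<n+1 = ≤-pred (subst (m ℕ.<_) (+-comm n 1) m<n+1)

  ∑row≤n+1 : ∀ i m → (∑< m) (row i) ≤ n + 1
  ∑row≤n+1 i = ∑-bounded (row-binary i) (λ j aij → proj₁ (one⁻ i j aij))

  ∑col≤n+1 : ∀ j m → (∑< m) (col j) ≤ n + 1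
  ∑col≤n+1 j = ∑-bounded (col-binary j) (λ i aij → proj₁ (proj₂ (one⁻ i j aij)))

  length-otherOnes-row : ∀ {i j m} → j ℕ.< m → a i j ≡ 1 → length (otherOnes (row i) m j) ≤ n
  length-otherOnes-row {i} {m = m} j<m aij =
    <n+1⇒≤n (<-≤-trans (length-otherOnes (row-binary i) j<m aij) (∑row≤n+1 i m))

  length-otherOnes-col : ∀ {i j m} → i ℕ.< m → a i j ≡ 1 → length (otherOnes (col j) m i) ≤ n
  length-otherOnes-col {i} {j} {m} i<m aij =
    <n+1⇒≤n (<-≤-trans (length-otherOnes (col-binary j) i<m aij) (∑col≤n+1 j m))

  length-ones-above : ∀ {k j} → a k j ≡ 1 → length (ones (col j) k) ≤ n
  length-ones-above {k} {j} akj = ≤-trans (≤-reflexive (length-ones (col-binary j) k))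
    (<n+1⇒≤n (proj₁ (proj₂ (one⁻ k j akj))))

  length-ones-before : ∀ {k l} → a k l ≡ 1 → length (ones (row k) l) ≤ n
  length-ones-before {k} {l} akl = ≤-trans (≤-reflexive (length-ones (row-binary k) l))
    (<n+1⇒≤n (proj₁ (one⁻ k l akl)))

  Blocked : ℕ → ℕ → Set
  Blocked k l = ∃[ i ] i ℕ.< k × ∃[ j ] j ℕ.< l × a i j ≡ 1 × a i l ≡ 1 × a k j ≡ 1

  -- With room left in the row and in the column, only the rectangle condition can fail, and a
  -- bounded search then produces the rectangle.
  one-or-blocked : ∀ k l → (∑< l) (row k) ℕ.< n + 1 → (∑< k) (col l) ℕ.< n + 1 →
                   a k l ≡ 1 ⊎ Blocked k l
  one-or-blocked k l row<n+1 col<n+1 with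
    anyUpTo? (λ i → anyUpTo? (λ j → (a i j ≟ 1) ×-dec (a i l ≟ 1) ×-dec (a k j ≟ 1)) l) k
  ... | yes b = inj₂ b
  ... | no ¬b = inj₁ (one⁺ k l (row<n+1 , col<n+1 , ¬b))

  Full : ℕ → ℕ → Set
  Full k c = ¬ ((∑< k) (col c) ℕ.< n + 1)

  full? : ∀ k → Decidable (Full k)
  full? k c = ¬? (_ <? _)

  -- Counting the columns between two ones of a row.

  module Span (k f d : ℕ) (akf : a k f ≡ 1) (akl : a k (f + d) ≡ 1) where

    l : ℕ
    l = f + d

    columns : List ℕ
    columns = applyUpTo (λ x → f + x) (suc d)

    ∈-columns⁻ : ∀ {c} → c ∈ columns → f ≤ c × c ≤ l
    ∈-columns⁻ c∈ with ∈-applyUpTo⁻ (λ x → f + x) c∈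
    ... | x , s≤s x≤d , refl = m≤m+n f x , +-monoʳ-≤ f x≤d

    columns-unique : Unique columns
    columns-unique = Unique.applyUpTo⁺₁ _ (suc d) λ i<j _ eq → <⇒≢ i<j (+-cancelˡ-≡ f _ _ eq)

    full : List ℕ
    full = filter (full? k) columns

    ∈-full⁻ : ∀ {c} → c ∈ full → f ℕ.< c × c ≤ l × Full k c
    ∈-full⁻ c∈ with ∈-filter⁻ (full? k) {xs = columns} c∈
    ... | c∈columns , c-full with ∈-columns⁻ c∈columns
    -- The one at `(k , f)` was admissible, so column `f` is not full; this makes the inequality
    -- strict.
    ...   | f≤c , c≤l = ≤∧≢⇒< f≤c (λ where refl → c-full (proj₁ (proj₂ (one⁻ k f akf)))) , c≤l , c-full

    blockedBy : ℕ → List ℕ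
    blockedBy j = concatMap (λ i → otherOnes (row i) (suc l) j) (ones (col j) k)

    blocked : List ℕ
    blocked = concatMap blockedBy (ones (row k) l)

    -- Three nested choices with at most `n` options each: a one `j` of row `k` before `l`, a one
    -- above it in column `j`, and a different one in the row so reached.
    length-blocked : length blocked ≤ n ℕ.* (n ℕ.* n)
    length-blocked = length-concatMap-≤ blockedBy (ones (row k) l) (length-ones-before akl) λ j∈ →
      let j<l , akj = ∈-ones⁻ j∈ in
      length-concatMap-≤ _ (ones (col _) k) (length-ones-above akj) λ i∈ →
      length-otherOnes-row (m≤n⇒m≤1+n j<l) (proj₂ (∈-ones⁻ i∈))

    columns-cover : columns ⊆ ones (row k) (suc l) ++ blocked ++ full
    columns-cover {c} c∈ with (∑< k) (col c) <? n + 1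
    ... | no c-full = ∈-++⁺ʳ (ones (row k) (suc l)) (∈-++⁺ʳ blocked (∈-filter⁺ (full? k) c∈ c-full))
    ... | yes col<n+1 with ∈-columns⁻ c∈
    -- Row `k` still has room at `l`, where it places a one, and hence also at the earlier column
    -- `c`.
    ...   | _ , c≤l with one-or-blocked k c
                          (≤-<-trans (∑-mono-≤ (row k) c≤l) (proj₁ (one⁻ k l akl))) col<n+1
    ...     | inj₁ akc = ∈-++⁺ˡ (∈-ones⁺ (s≤s c≤l) akc)
    ...     | inj₂ (i , i<k , j , j<c , aij , aic , akj) =
                ∈-++⁺ʳ (ones (row k) (suc l)) (∈-++⁺ˡ
                  (∈-concatMap⁺ blockedBy (∈-ones⁺ (<-≤-trans j<c c≤l) akj)
                  (∈-concatMap⁺ _ (∈-ones⁺ i<k aij)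
                  (∈-otherOnes⁺ (s≤s c≤l) aic (>⇒≢ j<c)))))

    -- Given a one (i , j) with j ≠ f in a row i that meets column f: the entry itself if j > f,
    -- and otherwise the ones of the rows that (i , j) blocks at column f. Entries are stored
    -- column first.
    spread : ∀ i j → Dec (j ℕ.< f) → List (ℕ × ℕ)
    spread i j (no  _) = [ (j , i) ]
    spread i j (yes _) =
      concatMap (λ i′ → map (_, i′) (otherOnes (row i′) (suc l) j)) (otherOnes (col j) k i)

    length-spread : ∀ i j dec → i ℕ.< k → j ℕ.< suc l → a i j ≡ 1 →
                    length (spread i j dec) ≤ n ℕ.* n
    -- A single entry fits into `n · n` because `n` is positive.
    length-spread i j (no  _) _   _    _   = *-mono-≤ 1≤n 1≤n
    length-spread i j (yes _) i<k j<1+l aij =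
      length-concatMap-≤ _ (otherOnes (col j) k i) (length-otherOnes-col i<k aij) λ {i′} i′∈ →
      ≤-trans (≤-reflexive (length-map (_, i′) (otherOnes (row i′) (suc l) j)))
              (length-otherOnes-row j<1+l (proj₂ (∈-otherOnes⁻ i′∈)))

    spreadRow : ℕ → List (ℕ × ℕ)
    spreadRow i = concatMap (λ j → spread i j (j <? f)) (otherOnes (row i) (suc l) f)

    rightOnes : List (ℕ × ℕ)
    rightOnes = concatMap spreadRow (ones (col f) k)

    -- At most `n` rows above `k` meet column `f`, each has at most `n` other ones in range, and
    -- each of these spreads to at most `n · n` entries.
    length-rightOnes : length rightOnes ≤ n ℕ.* (n ℕ.* (n ℕ.* n))
    length-rightOnes =
      length-concatMap-≤ spreadRow (ones (col f) k) (length-ones-above akf) λ {i} i∈ →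
      let i<k , aif = ∈-ones⁻ i∈ in
      length-concatMap-≤ _ (otherOnes (row i) (suc l) f)
        (length-otherOnes-row (s≤s (m≤m+n f d)) aif) λ {j} j∈ →
      let j<1+l , aij = ∈-otherOnes⁻ j∈ in
      length-spread i j (j <? f) i<k j<1+l aij

    ∈-spread-right : ∀ {i j} dec → f ℕ.< j → (j , i) ∈ spread i j dec
    ∈-spread-right (no  _)   _   = here refl
    ∈-spread-right (yes j<f) f<j = contradiction j<f (<-asym f<j)

    ∈-spread-left : ∀ {i j i′ c} dec → j ℕ.< f → i ℕ.< i′ → i′ ℕ.< k → a i′ j ≡ 1 →
                    f ℕ.< c → c ≤ l → a i′ c ≡ 1 → (c , i′) ∈ spread i j dec
    ∈-spread-left (no  j≮f) j<f _ _ _ _ _ _ = contradiction j<f j≮f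
    ∈-spread-left (yes _) j<f i<i′ i′<k ai′j f<c c≤l ai′c =
      ∈-concatMap⁺ _ (∈-otherOnes⁺ i′<k ai′j (>⇒≢ i<i′))
      (∈-map⁺ _ (∈-otherOnes⁺ (s≤s c≤l) ai′c (>⇒≢ (<-trans j<f f<c))))

    ∈-rightOnes : ∀ {i c} → i ℕ.< k → f ℕ.< c → c ≤ l → a i c ≡ 1 → (c , i) ∈ rightOnes
    ∈-rightOnes {i} {c} i<k f<c c≤l aic with one-or-blocked i f
        -- Room in row `i` is inherited from its one at `c`, and room in column `f` from the one at
        -- `(k , f)` further down.
        (≤-<-trans (∑-mono-≤ (row i) (<⇒≤ f<c)) (proj₁ (one⁻ i c aic)))
        (≤-<-trans (∑-mono-≤ (col f) (<⇒≤ i<k)) (proj₁ (proj₂ (one⁻ k f akf))))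
    ... | inj₁ aif =
            ∈-concatMap⁺ spreadRow (∈-ones⁺ i<k aif)
            (∈-concatMap⁺ _ (∈-otherOnes⁺ (s≤s c≤l) aic (>⇒≢ f<c))
            (∈-spread-right (c <? f) f<c))
    -- Row `i₀` meets column `f` and has a one at `j < f`; column `j` leads down to row `i`, which
    -- contains the entry sought.
    ... | inj₂ (i₀ , i₀<i , j , j<f , ai₀j , ai₀f , aij) =
            ∈-concatMap⁺ spreadRow (∈-ones⁺ (<-trans i₀<i i<k) ai₀f)
            (∈-concatMap⁺ _ (∈-otherOnes⁺ (m≤n⇒m≤1+n (<-≤-trans j<f (m≤m+n f d))) ai₀j (<⇒≢ j<f))
            (∈-spread-left (j <? f) j<f i₀<i i<k aij f<c c≤l aic))

    entry : ℕ × ℕ → ℕ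
    entry = uncurry col

    fullOnes : List (ℕ × ℕ)
    fullOnes = filter (λ p → entry p ≟ 1) (cartesianProduct full (upTo k))

    -- `length-⊆` asks for distinctness on this side only, so `rightOnes` is free to list an entry
    -- several times.
    fullOnes-unique : Unique fullOnes
    fullOnes-unique = Unique.filter⁺ _
      (Unique.cartesianProduct⁺ (Unique.filter⁺ (full? k) columns-unique) (Unique.upTo⁺ k))

    fullOnes⊆rightOnes : fullOnes ⊆ rightOnes
    fullOnes⊆rightOnes {c , i} ci∈ with
      ∈-filter⁻ (λ p → entry p ≟ 1) {xs = cartesianProduct full (upTo k)} ci∈
    ... | ci∈× , aic with ∈-cartesianProduct⁻ full (upTo k) ci∈×
    ...   | c∈ , i∈ with ∈-full⁻ c∈
    ...     | f<c , c≤l , _ = ∈-rightOnes (∈-upTo⁻ i∈) f<c c≤l aic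

    -- Double count of the ones above row `k` in full columns: at least `n + 1` per column, and all
    -- of them occur in `rightOnes`.
    length-full : length full ℕ.* (n + 1) ≤ n ℕ.* (n ℕ.* (n ℕ.* n))
    length-full = begin
      length full ℕ.* (n + 1)
        ≤⟨ sum-cartesianProduct-≥ entry (n + 1) full (upTo k) (λ {c} c∈ →
             ≤-trans (≮⇒≥ (proj₂ (proj₂ (∈-full⁻ c∈)))) (≤-reflexive (cong sum (sym (map-upTo (col c) k))))) ⟩
      sum (map entry (cartesianProduct full (upTo k)))
        ≡⟨ length-filter-ones (λ (c , i) → binary i c) (cartesianProduct full (upTo k)) ⟨
      length fullOnes
        ≤⟨ length-⊆ fullOnes-unique fullOnes⊆rightOnes ⟩
      length rightOnes
        ≤⟨ length-rightOnes ⟩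
      n ℕ.* (n ℕ.* (n ℕ.* n)) ∎
      where open ≤-Reasoning

    -- F + n² ≥ n³ + n would give F (n + 1) ≥ n⁴ + n after multiplication by n + 1.
    full-bound : length full + n ℕ.* n ℕ.< n ℕ.* (n ℕ.* n) + n
    full-bound = ≰⇒> λ h → <-irrefl refl (begin-strict
      n⁴ + n ℕ.* n ℕ.* (n + 1)
        <⟨ m<m+n _ 1≤n ⟩
      n⁴ + n ℕ.* n ℕ.* (n + 1) + n
        ≡⟨ expand n ⟨
      (n ℕ.* (n ℕ.* n) + n) ℕ.* (n + 1)
        ≤⟨ *-monoˡ-≤ (n + 1) h ⟩
      (length full + n ℕ.* n) ℕ.* (n + 1)
        ≡⟨ *-distribʳ-+ (n + 1) (length full) (n ℕ.* n) ⟩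
      length full ℕ.* (n + 1) + n ℕ.* n ℕ.* (n + 1)
        ≤⟨ +-monoˡ-≤ _ length-full ⟩
      n⁴ + n ℕ.* n ℕ.* (n + 1) ∎)
      where
      open ≤-Reasoning
      n⁴ = n ℕ.* (n ℕ.* (n ℕ.* n))
      expand : ∀ n → (n ℕ.* (n ℕ.* n) + n) ℕ.* (n + 1) ≡
                     n ℕ.* (n ℕ.* (n ℕ.* n)) + n ℕ.* n ℕ.* (n + 1) + n
      expand = solve-∀

    -- The claimed bound equals 2n³ + 3n - n². Moving n² to the left avoids subtraction in `ℕ`.
    span-bound : d + 1 + n ℕ.* n ℕ.< 2 ℕ.* (n ℕ.* (n ℕ.* n)) + 3 ℕ.* n
    span-bound = begin-strict
      d + 1 + n ℕ.* n
        ≡⟨ cong (_+ n ℕ.* n) (trans (+-comm d 1) (sym (length-applyUpTo (λ x → f + x) (suc d)))) ⟩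
      length columns + n ℕ.* n
        ≤⟨ +-monoˡ-≤ (n ℕ.* n) (length-⊆ columns-unique columns-cover) ⟩
      length (ones (row k) (suc l) ++ blocked ++ full) + n ℕ.* n
        ≡⟨ cong (_+ n ℕ.* n) (trans (length-++ (ones (row k) (suc l)))
             (cong (length (ones (row k) (suc l)) ℕ.+_) (length-++ blocked))) ⟩
      length (ones (row k) (suc l)) + (length blocked + length full) + n ℕ.* n
        ≡⟨ regroup (length (ones (row k) (suc l))) _ _ _ ⟩
      length (ones (row k) (suc l)) + length blocked + (length full + n ℕ.* n)
        <⟨ +-mono-≤-< (+-mono-≤
             (≤-trans (≤-reflexive (length-ones (row-binary k) (suc l))) (∑row≤n+1 k (suc l)))
             length-blocked) full-bound ⟩
      n + 1 + n³ + (n³ + n)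
        -- The three kinds give less than 2n³ + 2n + 1 in total; `1 ≤ n` absorbs the 1 into a third
        -- `n`.
        ≤⟨ +-monoˡ-≤ (n³ + n) (+-monoˡ-≤ n³ (+-monoʳ-≤ n 1≤n)) ⟩
      n + n + n³ + (n³ + n)
        ≡⟨ collect n n³ ⟩
      2 ℕ.* n³ + 3 ℕ.* n ∎
      where
      open ≤-Reasoning
      n³ = n ℕ.* (n ℕ.* n)
      regroup : ∀ x y z w → x + (y + z) + w ≡ x + y + (z + w)
      regroup = solve-∀
      collect : ∀ x y → x + x + y + (y + x) ≡ 2 ℕ.* y + 3 ℕ.* x
      collect = solve-∀

  -- Existence of the first and last one in every row.

  bound : ℕ
  bound = 2 ℕ.* (n ℕ.* (n ℕ.* n)) + 3 ℕ.* n

  row-span : ∀ {k f l} → a k f ≡ 1 → a k l ≡ 1 → f ≤ l → l ∸ f + 1 + n ℕ.* n ℕ.< bound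
  row-span {k} {f} {l} akf akl f≤l =
    Span.span-bound k f (l ∸ f) akf (subst (λ c → a k c ≡ 1) (sym (m+[n∸m]≡n f≤l)) akl)

  -- `row-span` holds for any two ones of a row, so it confines the ones to a finite window before
  -- the last one is known; `greatest` searches that window.
  row-span-≤ : ∀ {k f c} → a k f ≡ 1 → a k c ≡ 1 → f ≤ c → c ≤ f + bound
  row-span-≤ {k} {f} {c} akf akc f≤c = begin
    c                           ≡⟨ m+[n∸m]≡n f≤c ⟨
    f + (c ∸ f)                 ≤⟨ +-monoʳ-≤ f (m≤m+n (c ∸ f) 1) ⟩
    f + (c ∸ f + 1)             ≤⟨ +-monoʳ-≤ f (m≤m+n (c ∸ f + 1) (n ℕ.* n)) ⟩
    f + (c ∸ f + 1 + n ℕ.* n)   ≤⟨ +-monoʳ-≤ f (<⇒≤ (row-span akf akc f≤c)) ⟩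
    f + bound                   ∎
    where open ≤-Reasoning

  Width : ℕ → ℕ → Set
  Width k w = ∀ i j → i ℕ.< k → a i j ≡ 1 → j ℕ.< w

  -- Column `w` lies beyond every one of the earlier rows. If row `k` has no one before `w`, nothing
  -- prevents a one at `w`.
  row-one : ∀ k w → Width k w → ∃[ j ] a k j ≡ 1
  row-one k w rows with anyUpTo? (λ j → a k j ≟ 1) w
  ... | yes (j , _ , akj) = j , akj
  ... | no none = w , one⁺ k w
        ( subst (ℕ._< n + 1) (sym (∑-zero w row-zero)) (m≤n+m 1 n)
        , subst (ℕ._< n + 1) (sym (∑-zero k col-zero)) (m≤n+m 1 n)
        -- A blocking rectangle would need a one in column `w` above row `k`.
        , λ (i , i<k , _ , _ , _ , aiw , _) → <-irrefl refl (rows i w i<k aiw))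
    where
    row-zero : ∀ j → j ℕ.< w → a k j ≡ 0
    row-zero j j<w with binary k j
    ... | inj₁ akj≡0 = akj≡0
    ... | inj₂ akj≡1 = contradiction (j , j<w , akj≡1) none
    col-zero : ∀ i → i ℕ.< k → a i w ≡ 0
    col-zero i i<k with binary i w
    ... | inj₁ aiw≡0 = aiw≡0
    ... | inj₂ aiw≡1 = contradiction (rows i w i<k aiw≡1) (<-irrefl refl)

  length-of-nonempty : ∀ k j → a k j ≡ 1 → ∃[ m ] HasLength (a k) m × m + n ℕ.* n ℕ.< bound
  length-of-nonempty k j akj =
    let f , akf , min = least (λ j → a k j ≟ 1) j akj
        l , akl , max = greatest (λ j → a k j ≟ 1) akj (f + bound)
                          (λ c akc → row-span-≤ akf akc (min c akc))
    in l ∸ f + 1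
     , record { first = f ; last = l ; first-one = akf ; first-minimal = min
              ; last-one = akl ; last-maximal = max ; length = refl }
     , row-span akf akl (min l akl)

  width-suc : ∀ {k w m} → Width k w → (len : HasLength (a k) m) →
              Width (suc k) (w ⊔ suc (HasLength.last len))
  width-suc {w = w} rows len i j i<1+k aij with m<1+n⇒m<n∨m≡n i<1+k
  ... | inj₁ i<k  = <-≤-trans (rows i j i<k aij) (m≤m⊔n w _)
  ... | inj₂ refl = <-≤-trans (s≤s (HasLength.last-maximal len j aij)) (m≤n⊔m w _)

  mutual
    -- The recursion is well founded: row `k` needs the width of the rows above it, and that width
    -- needs only the lengths of those rows.
    row-length : ∀ k → ∃[ m ] HasLength (a k) m × m + n ℕ.* n ℕ.< bound
    row-length k = uncurry (length-of-nonempty k) (uncurry (row-one k) (rows-width k))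

    rows-width : ∀ k → ∃[ w ] Width k w
    rows-width zero    = 0 , λ _ _ ()
    rows-width (suc k) =
      let _ , rows    = rows-width k
          _ , len , _ = row-length k
      in _ , width-suc rows len

-- Application to `A n` and passage to the integers.

A-binary : ∀ n k l → A n k l ≡ 0 ⊎ A n k l ≡ 1
A-binary n k l with admissible? n (A n) k l
... | yes adm = inj₂ (A-one n k l adm)
... | no ¬adm = inj₁ (A-zero n k l ¬adm)

A-one⁻ : ∀ n k l → A n k l ≡ 1 → Admissible n (A n) k l
A-one⁻ n k l akl = decidable-stable (admissible? n (A n) k l) λ ¬adm →
  0≢1+n (trans (sym (A-zero n k l ¬adm)) akl)

-- Subtracting n² from both sides is done in `ℤ`, where n - 3 may be negative.
bound-ℤ : ∀ n m → m + n ℕ.* n ℕ.< 2 ℕ.* (n ℕ.* (n ℕ.* n)) + 3 ℕ.* n →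
          (+ m) < (+ 2) * (+ n) ^ 3 - (+ n) * ((+ n) - (+ 3))
bound-ℤ n m h = begin-strict
  + m
    ≡⟨ cancel (+ m) (+ n) ⟩
  (+ m ℤ.+ + n * + n) - + n * + n
    ≡⟨ cong (λ x → (+ m ℤ.+ x) - + n * + n) (ℤ.pos-* n n) ⟨
  + (m + n ℕ.* n) - + n * + n
    <⟨ ℤ.+-monoˡ-< (ℤ.- (+ n * + n)) (ℤ.+<+ h) ⟩
  + (2 ℕ.* (n ℕ.* (n ℕ.* n)) + 3 ℕ.* n) - + n * + n
    ≡⟨ cong (_- + n * + n) (cong₂ ℤ._+_ cube (ℤ.pos-* 3 n)) ⟩
  (+ 2 * (+ n * (+ n * + n)) ℤ.+ + 3 * + n) - + n * + n
    ≡⟨ rearrange (+ n) ⟩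
  + 2 * (+ n) ^ 3 - + n * (+ n - + 3) ∎
  where
  open ℤ.≤-Reasoning
  cube : + (2 ℕ.* (n ℕ.* (n ℕ.* n))) ≡ + 2 * (+ n * (+ n * + n))
  cube = trans (ℤ.pos-* 2 (n ℕ.* (n ℕ.* n))) (cong (+ 2 *_) (trans (ℤ.pos-* n (n ℕ.* n)) (cong (+ n *_) (ℤ.pos-* n n))))
  cancel : ∀ x y → x ≡ (x ℤ.+ y * y) - y * y
  cancel = ℤ-Solver.solve-∀
  -- The product ending in `+ 1` is what the cube unfolds to.
  rearrange : ∀ x → (+ 2 * (x * (x * x)) ℤ.+ + 3 * x) - x * x ≡ + 2 * (x * (x * (x * + 1))) - x * (x - + 3)
  rearrange = ℤ-Solver.solve-∀

theorem3p1 : ∀ (n : ℕ) → 1 ≤ n → ∀ (k : ℕ) →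
    ∃[ m ] HasLength (A n k) m × (+ m) < (+ 2) * (+ n) ^ 3 - (+ n) * ((+ n) - (+ 3))
theorem3p1 n 1≤n k =
  let m , len , h = Greedy.row-length n 1≤n (A n) (A-binary n) (A-one n) (A-one⁻ n) k
  in m , len , bound-ℤ n m h
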